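{- Let $G$ be a strongly regular graph with parameters $(n,k,a,c)$ such that $k$ is odd and $a$ and $c$ are even. Then the coefficients of the interlace polynomial $q(G,x)$ are all even.
   Context: Graphs are finite, undirected and simple with vertex set $\{1,\dots,n\}$. A graph is strongly regular with parameters $(n,k,a,c)$ if it has $n$ vertices, each vertex has degree $k$, $|N(i)\cap N(j)|=a$ for every two adjacent vertices $i,j$, and $|N(i)\cap N(j)|=c$ for every two distinct non-adjacent vertices $i,j$, where $N(i)$ is the neighborhood of $i$. Let $\Gamma$ be the adjacency matrix of $G$ over $\mathbb{F}_2$; for $\omega\subseteq\{1,\dots,n\}$ put $\Gamma[\omega]=(\Gamma_{ij})_{i,j\in\omega}$ and let $s(\Gamma[\omega])$ be the dimension of its kernel over $\mathbb{F}_2$, with $s(\Gamma[\emptyset])=0$. The interlace polynomial of $G$ is the integer polynomial $q(G,x)=\sum_{\omega\subseteq\{1,\dots,n\}}(x-1)^{s(\Gamma[\omega])}$. -}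

module Defs where

import Algebra.Properties.CommutativeMonoid.Sum as Sum
open import Data.Bool.Base using (if_then_else_)
open import Data.Empty using (⊥-elim)
open import Data.Fin.Base using (Fin; zero; suc)
open import Data.Fin.Properties using (all?)
open import Data.Fin.Subset using (Subset; inside; outside; ∣_∣; _∩_)
open import Data.Integer.Base as ℤ using (ℤ; 0ℤ; 1ℤ; -1ℤ)
open import Data.List.Base as List using (List; []; _∷_; _++_)
open import Data.Nat.Base using (ℕ; zero; suc)
open import Data.Parity.Base using (Parity; 0ℙ; 1ℙ; _+_)
  renaming (_*_ to infixl 8 _*_)  -- the library gives _+_ and _*_ equal precedence
open import Data.Parity.Properties
open import Data.Product.Base using (Σ; ∃; _,_; proj₁)
open import Data.Vec.Base as Vec using ([]; _∷_)
open import Data.Vec.Functional as Vector using (Vector; head; tail)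
open import Function.Base using (_∘_; const)
open import Level using (0ℓ)
open import Relation.Binary.Core using (Rel)
open import Relation.Binary.Definitions using (Decidable; Irreflexive; Symmetric)
open import Relation.Binary.PropositionalEquality hiding (resp)
open import Relation.Nullary using (Dec; yes; no; ¬_; does)
open import Relation.Nullary.Decidable using (map′)
import Relation.Unary as U

record Graph (n : ℕ) : Set₁ where
  infix 4 _~_ _~?_
  field
    _~_      : Rel (Fin n) 0ℓ
    _~?_     : Decidable _~_
    ~-sym    : Symmetric _~_
    ~-irrefl : Irreflexive _≡_ _~_

  N : Fin n → Subset n
  N i = Vec.tabulate (λ j → does (i ~? j))

record IsStronglyRegular {n} (G : Graph n) (k a c : ℕ) : Set where
  open Graph G
  field
    degree      : ∀ i → ∣ N i ∣ ≡ k
    adjacent    : ∀ i j → i ~ j → ∣ N i ∩ N j ∣ ≡ a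
    nonadjacent : ∀ i j → i ≢ j → ¬ (i ~ j) → ∣ N i ∩ N j ∣ ≡ c

-- Data.Parity is the two-element field: 1ℙ + 1ℙ = 0ℙ.
𝔽₂ : Set
𝔽₂ = Parity

open Sum +-0-commutativeMonoid public using (sum; sum-cong-≗; sum-replicate-zero; ∑-distrib-+)

𝔽₂^_ : ℕ → Set
𝔽₂^ m = Vector 𝔽₂ m

Matrix : ℕ → ℕ → Set
Matrix m n = Fin m → Fin n → 𝔽₂

infixl 7 _·_
infixl 6 _⊕_

_·_ : ∀ {m n} → Matrix m n → 𝔽₂^ n → 𝔽₂^ m
(A · v) i = sum (λ j → A i j * v j)

_⊕_ : ∀ {m} → 𝔽₂^ m → 𝔽₂^ m → 𝔽₂^ m
(v ⊕ w) i = v i + w i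

𝟎 : ∀ {m} → 𝔽₂^ m
𝟎 = const 0ℙ

-- Closure under scalars is automatic over 𝔽₂.
record IsSubspace {m} (W : 𝔽₂^ m → Set) : Set where
  field
    resp  : ∀ {v w} → v ≗ w → W v → W w
    𝟎∈    : W 𝟎
    ⊕∈    : ∀ {v w} → W v → W w → W (v ⊕ w)

combination : ∀ {m d} → (Fin d → 𝔽₂^ m) → 𝔽₂^ d → 𝔽₂^ m
combination b x i = sum (λ j → x j * b j i)

record IsBasis {m d} (W : 𝔽₂^ m → Set) (b : Fin d → 𝔽₂^ m) : Set where
  field
    member      : ∀ j → W (b j)
    independent : ∀ x → combination b x ≗ 𝟎 → x ≗ 𝟎
    spanning    : ∀ v → W v → ∃ λ x → combination b x ≗ v

any𝔽₂^? : ∀ {m} {P : 𝔽₂^ m → Set} → (∀ {v w} → v ≗ w → P v → P w) →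
          U.Decidable P → Dec (∃ P)
any𝔽₂^? {zero} resp P? =
  map′ (λ p → 𝟎 , p) (λ (v , p) → resp (λ ()) p) (P? 𝟎)
any𝔽₂^? {suc m} {P} resp P? with rec 0ℙ | rec 1ℙ
  where
  cong-∷ : ∀ x {v w : 𝔽₂^ m} → v ≗ w → (x Vector.∷ v) ≗ (x Vector.∷ w)
  cong-∷ x e zero    = refl
  cong-∷ x e (suc i) = e i
  rec : ∀ x → Dec (∃ λ v → P (x Vector.∷ v))
  rec x = any𝔽₂^? (λ e → resp (cong-∷ x e)) (λ v → P? (x Vector.∷ v))
... | yes (v , p) | _           = yes (_ , p)
... | no _        | yes (v , p) = yes (_ , p)
... | no ¬p₀      | no ¬p₁      = no λ (v , p) → go v p (head v) refl
  where
  η : ∀ (v : 𝔽₂^ suc m) x → head v ≡ x → v ≗ (x Vector.∷ tail v)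
  η v x e zero    = e
  η v x e (suc i) = refl
  go : ∀ v → P v → ∀ x → head v ≡ x → _
  go v p 0ℙ e = ¬p₀ (tail v , resp (η v 0ℙ e) p)
  go v p 1ℙ e = ¬p₁ (tail v , resp (η v 1ℙ e) p)

sum-zeros : ∀ {d} (x : 𝔽₂^ d) → sum (λ j → x j * 0ℙ) ≡ 0ℙ
sum-zeros {d} x = trans (sum-cong-≗ (*-zeroʳ ∘ x)) (sum-replicate-zero d)

basis : ∀ {m} (W : 𝔽₂^ m → Set) → IsSubspace W → U.Decidable W →
        ∃ λ d → Σ (Fin d → 𝔽₂^ m) (IsBasis W)
basis {zero} W S W? = 0 , (λ ()) , record
  { member      = λ ()
  ; independent = λ _ _ ()
  ; spanning    = λ _ _ → (λ ()) , λ ()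
  }
basis {suc m} W S W? =
  extend (basis W₀ S₀ (W? ∘ (0ℙ Vector.∷_))) (any𝔽₂^? (resp ∘ cong-∷) (W? ∘ (1ℙ Vector.∷_)))
  where
  open IsSubspace S

  cong-∷ : ∀ {x} {v w : 𝔽₂^ m} → v ≗ w → (x Vector.∷ v) ≗ (x Vector.∷ w)
  cong-∷ e zero    = refl
  cong-∷ e (suc i) = e i

  0∷𝟎 : 𝟎 ≗ (0ℙ Vector.∷ 𝟎 {m})
  0∷𝟎 zero    = refl
  0∷𝟎 (suc i) = refl

  0∷⊕ : ∀ {v w : 𝔽₂^ m} → (0ℙ Vector.∷ v) ⊕ (0ℙ Vector.∷ w) ≗ (0ℙ Vector.∷ v ⊕ w)
  0∷⊕ zero    = refl
  0∷⊕ (suc i) = refl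

  W₀ : 𝔽₂^ m → Set
  W₀ v = W (0ℙ Vector.∷ v)

  S₀ : IsSubspace W₀
  S₀ = record
    { resp = resp ∘ cong-∷
    ; 𝟎∈   = resp 0∷𝟎 𝟎∈
    ; ⊕∈   = λ p q → resp 0∷⊕ (⊕∈ p q)
    }

  η₀ : ∀ (v : 𝔽₂^ suc m) → head v ≡ 0ℙ → v ≗ (0ℙ Vector.∷ tail v)
  η₀ v e zero    = e
  η₀ v e (suc i) = refl

  extend : ∃ (λ d → Σ (Fin d → 𝔽₂^ m) (IsBasis W₀)) →
           Dec (∃ λ w → W (1ℙ Vector.∷ w)) →
           ∃ λ d → Σ (Fin d → 𝔽₂^ suc m) (IsBasis W)
  extend (d , b , isBasis) (no ¬w) = d , b′ , record
    { member      = member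
    ; independent = λ x e → independent x (e ∘ suc)
    ; spanning    = λ v p → span v p (head v) refl
    }
    where
    open IsBasis isBasis
    b′ : Fin d → 𝔽₂^ suc m
    b′ j = 0ℙ Vector.∷ b j
    span : ∀ v → W v → ∀ h → head v ≡ h → ∃ λ x → combination b′ x ≗ v
    span v p 0ℙ e with x , q ← spanning (tail v) (resp (η₀ v e) p) = x , λ where
      zero    → trans (sum-zeros x) (sym e)
      (suc i) → q i
    span v p 1ℙ e = ⊥-elim (¬w (tail v , resp (λ { zero → e ; (suc i) → refl }) p))
  extend (d , b , isBasis) (yes (w , Ww)) = suc d , b′ , record
    { member      = λ { zero → Ww ; (suc j) → member j }
    ; independent = indep
    ; spanning    = λ v p → span v p (head v) refl
    }
    where
    open IsBasis isBasis
    b′ : Fin (suc d) → 𝔽₂^ suc m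
    b′ zero    = 1ℙ Vector.∷ w
    b′ (suc j) = 0ℙ Vector.∷ b j

    indep : ∀ x → combination b′ x ≗ 𝟎 → x ≗ 𝟎
    indep x e = λ { zero → x₀≡0 ; (suc j) → independent (tail x) rest j }
      where
      x₀≡0 : head x ≡ 0ℙ
      x₀≡0 = begin
        head x                                          ≡⟨ *-identityʳ _ ⟨
        head x * 1ℙ                                     ≡⟨ +-identityʳ _ ⟨
        head x * 1ℙ + 0ℙ                                ≡⟨ cong (head x * 1ℙ +_) (sum-zeros (tail x)) ⟨
        head x * 1ℙ + sum (λ j → tail x j * 0ℙ)         ≡⟨ e zero ⟩
        0ℙ                                              ∎
        where open ≡-Reasoning
      rest : combination b (tail x) ≗ 𝟎
      rest i = subst (λ h → h * w i + combination b (tail x) i ≡ 0ℙ) x₀≡0 (e (suc i))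

    span : ∀ v → W v → ∀ h → head v ≡ h → ∃ λ x → combination b′ x ≗ v
    span v p 0ℙ e with x , q ← spanning (tail v) (resp (η₀ v e) p) =
      (0ℙ Vector.∷ x) , λ where
        zero    → trans (sum-zeros x) (sym e)
        (suc i) → q i
    span v p 1ℙ e
      with x , q ← spanning (tail v ⊕ w) (resp (λ { zero → cong (_+ 1ℙ) e ; (suc i) → refl }) (⊕∈ p Ww)) =
      (1ℙ Vector.∷ x) , λ where
        zero    → trans (cong (1ℙ +_) (sum-zeros x)) (sym e)
        (suc i) → begin
          w i + combination b x i   ≡⟨ cong (w i +_) (q i) ⟩
          w i + (v (suc i) + w i)   ≡⟨ +-comm (w i) _ ⟩
          v (suc i) + w i + w i     ≡⟨ +-assoc (v (suc i)) _ _ ⟩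
          v (suc i) + (w i + w i)   ≡⟨ cong (v (suc i) +_) (p+p≡0ℙ (w i)) ⟩
          v (suc i) + 0ℙ            ≡⟨ +-identityʳ _ ⟩
          v (suc i)                 ∎
      where open ≡-Reasoning

Kernel : ∀ {m n} → Matrix m n → 𝔽₂^ n → Set
Kernel A v = A · v ≗ 𝟎

kernel-isSubspace : ∀ {m n} (A : Matrix m n) → IsSubspace (Kernel A)
kernel-isSubspace A = record
  { resp = λ v≗w Av i → trans (sum-cong-≗ (λ j → cong (A i j *_) (sym (v≗w j)))) (Av i)
  ; 𝟎∈   = λ i → sum-zeros (A i)
  ; ⊕∈   = λ {v} {w} Av Aw i → begin
      sum (λ j → A i j * (v j + w j))           ≡⟨ sum-cong-≗ (λ j → *-distribˡ-+ (A i j) (v j) (w j)) ⟩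
      sum (λ j → A i j * v j + A i j * w j)     ≡⟨ ∑-distrib-+ (λ j → A i j * v j) (λ j → A i j * w j) ⟩
      (A · v) i + (A · w) i                     ≡⟨ cong₂ _+_ (Av i) (Aw i) ⟩
      0ℙ                                        ∎
  }
  where open ≡-Reasoning

kernel? : ∀ {m n} (A : Matrix m n) → U.Decidable (Kernel A)
kernel? A v = all? (λ i → (A · v) i ≟ 0ℙ)

kernel-basis : ∀ {m n} (A : Matrix m n) → ∃ λ d → Σ (Fin d → 𝔽₂^ n) (IsBasis (Kernel A))
kernel-basis A = basis (Kernel A) (kernel-isSubspace A) (kernel? A)

-- The dimension of the kernel, as the size of the basis constructed above.
nullity : ∀ {m n} → Matrix m n → ℕ
nullity A = proj₁ (kernel-basis A)

-- The increasing enumeration of the elements of a subset.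
element : ∀ {n} (ω : Subset n) → Fin ∣ ω ∣ → Fin n
element (inside  ∷ ω) zero    = zero
element (inside  ∷ ω) (suc i) = suc (element ω i)
element (outside ∷ ω) i       = suc (element ω i)

infix 10 _⟦_⟧

_⟦_⟧ : ∀ {n} → Matrix n n → (ω : Subset n) → Matrix ∣ ω ∣ ∣ ω ∣
(A ⟦ ω ⟧) i j = A (element ω i) (element ω j)

adjacency : ∀ {n} → Graph n → Matrix n n
adjacency G i j = if does (i ~? j) then 1ℙ else 0ℙ
  where open Graph G

-- Integer polynomials as coefficient lists, constant term first; trailing
-- zeros are allowed, so a polynomial is determined by coeff, not by the list.
ℤ[x] : Set
ℤ[x] = List ℤ

coeff : ℤ[x] → ℕ → ℤ
coeff []      _       = 0ℤ
coeff (a ∷ p) zero    = a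
coeff (a ∷ p) (suc i) = coeff p i

infixl 6 _+ᴾ_
infixl 7 _*ᴾ_
infixr 8 _^ᴾ_

_+ᴾ_ : ℤ[x] → ℤ[x] → ℤ[x]
[]      +ᴾ q       = q
(a ∷ p) +ᴾ []      = a ∷ p
(a ∷ p) +ᴾ (b ∷ q) = a ℤ.+ b ∷ p +ᴾ q

_*ᴾ_ : ℤ[x] → ℤ[x] → ℤ[x]
[]      *ᴾ q = []
(a ∷ p) *ᴾ q = List.map (a ℤ.*_) q +ᴾ (0ℤ ∷ p *ᴾ q)

_^ᴾ_ : ℤ[x] → ℕ → ℤ[x]
p ^ᴾ zero  = 1ℤ ∷ []
p ^ᴾ suc e = p *ᴾ p ^ᴾ e

sumᴾ : List ℤ[x] → ℤ[x]
sumᴾ = List.foldr _+ᴾ_ []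

x-1 : ℤ[x]
x-1 = -1ℤ ∷ 1ℤ ∷ []

subsets : ∀ n → List (Subset n)
subsets zero    = [] ∷ []
subsets (suc n) = List.map (inside ∷_) (subsets n) ++ List.map (outside ∷_) (subsets n)

interlace : ∀ {n} → Graph n → ℤ[x]
interlace {n} G = sumᴾ (List.map (λ ω → x-1 ^ᴾ nullity (adjacency G ⟦ ω ⟧)) (subsets n))

-- The hypotheses on k, a and c say that Γ² = I over 𝔽₂.  If v lies in the
-- kernel of Γ[ω], extend it by zero to u: then Γ u vanishes on ω, and
-- Γ (Γ u) = u vanishes on the complement ∁ ω, so Γ u restricts to an element of
-- the kernel of Γ[∁ ω], from which v can be recovered.  Hence Γ[ω] and Γ[∁ ω]
-- have the same nullity, and as there is at least one vertex, ω ≠ ∁ ω: the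
-- terms of the interlace polynomial pair off into equal ones.

module Submission where

open import Defs
open import Data.Bool.Base using (Bool; true; false; not; _∧_; if_then_else_)
open import Data.Bool.Properties using (not-involutive)
open import Data.Fin.Base using (Fin; zero; suc; combine; finToFun; funToFin)
open import Data.Fin.Properties
  using (suc-injective; injective⇒≤; funToFin-finToFin; finToFun-funToFin)
open import Data.Fin.Subset using (Subset; inside; outside; ∣_∣; _∩_; _∈_; _∉_; ∁)
open import Data.Fin.Subset.Properties using (x∈∁p⇒x∉p; x∈p⇒x∉∁p)
open import Data.Integer.Base as ℤ using (ℤ; 0ℤ)
import Data.Integer.Properties as ℤ
open import Data.Integer.Divisibility as ℤ using ()
open import Data.List.Base as List using (List; []; _∷_; _++_)
open import Data.List.Properties using (map-++; map-∘; map-cong)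
open import Data.List.Relation.Binary.Permutation.Propositional
  using (_↭_; refl; prep; swap; trans; module PermutationReasoning)
open import Data.List.Relation.Binary.Permutation.Propositional.Properties
  using (map⁺; ++⁺; ++-comm)
open import Data.Nat.Base as ℕ using (ℕ; zero; suc; parity; NonZero; _≤_; _^_; s≤s; z≤n)
open import Data.Nat.Divisibility using (_∣_; _∤_; divides; ∣m∣n⇒∣m+n; ∣-refl)
import Data.Nat.Properties as ℕ
open import Data.Parity.Base using (Parity; 0ℙ; 1ℙ; _+_)
  renaming (_*_ to infixl 8 _*_)
open import Data.Parity.Properties
open import Data.Product.Base using (proj₁; proj₂)
open import Data.Vec.Base as Vec using ([]; _∷_; here; there)
import Data.Vec.Properties as Vec
open import Data.Vec.Functional using (head; tail)
open import Function.Base using (_∘_; id)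
open import Relation.Binary.PropositionalEquality as ≡ hiding (trans)
open import Relation.Nullary using (yes; no; does; contradiction)

open import Algebra.Properties.Semiring.Sum +-*-semiring
  using (∑-comm; *-distribˡ-sum; *-distribʳ-sum)

private variable
  m n d e : ℕ

-- Parities and sums over 𝔽₂

even⇒parity≡0ℙ : 2 ∣ n → parity n ≡ 0ℙ
even⇒parity≡0ℙ (divides q refl) = ≡.trans (*-homo-* q 2) (*-zeroʳ (parity q))

odd⇒parity≡1ℙ : ∀ n → 2 ∤ n → parity n ≡ 1ℙ
odd⇒parity≡1ℙ 0             2∤0 = contradiction (divides 0 refl) 2∤0
odd⇒parity≡1ℙ 1             _   = refl
odd⇒parity≡1ℙ (suc (suc n)) 2∤n = odd⇒parity≡1ℙ n (2∤n ∘ ∣m∣n⇒∣m+n ∣-refl)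

sum-select : ∀ (i : Fin n) (t : 𝔽₂^ n) → (∀ j → i ≢ j → t j ≡ 0ℙ) → sum t ≡ t i
sum-select {suc n} zero t t≡0 = begin
  head t + sum (tail t)    ≡⟨ cong (head t +_) (sum-cong-≗ λ j → t≡0 (suc j) λ ()) ⟩
  head t + sum {n} 𝟎       ≡⟨ cong (head t +_) (sum-replicate-zero n) ⟩
  head t + 0ℙ              ≡⟨ +-identityʳ _ ⟩
  head t                   ∎
  where open ≡-Reasoning
sum-select (suc i) t t≡0 =
  cong₂ _+_ (t≡0 zero λ ()) (sum-select i (tail t) λ j i≢j → t≡0 (suc j) (i≢j ∘ suc-injective))

p+q≡0⇒p≡q : ∀ p q → p + q ≡ 0ℙ → p ≡ q
p+q≡0⇒p≡q 0ℙ 0ℙ _ = refl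
p+q≡0⇒p≡q 1ℙ 1ℙ _ = refl

·-cong : ∀ (A : Matrix m n) {v w} → v ≗ w → A · v ≗ A · w
·-cong A v≗w i = sum-cong-≗ λ j → cong (A i j *_) (v≗w j)

-- Dimension

combination-⊕ : ∀ (b : Fin d → 𝔽₂^ m) x y →
                combination b (x ⊕ y) ≗ combination b x ⊕ combination b y
combination-⊕ b x y i = ≡.trans
  (sum-cong-≗ λ j → *-distribʳ-+ (b j i) (x j) (y j))
  (∑-distrib-+ (λ j → x j * b j i) (λ j → y j * b j i))

combination-∈ : ∀ {W : 𝔽₂^ m → Set} → IsSubspace W →
                ∀ (b : Fin d → 𝔽₂^ m) → (∀ j → W (b j)) → ∀ x → W (combination b x)
combination-∈ {d = zero}  S b b∈ x = IsSubspace.𝟎∈ S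
combination-∈ {d = suc d} {W} S b b∈ x =
  ⊕∈ (scale (head x)) (combination-∈ S (tail b) (b∈ ∘ suc) (tail x))
  where
  open IsSubspace S
  scale : ∀ c → W (λ i → c * b zero i)
  scale 0ℙ = 𝟎∈
  scale 1ℙ = b∈ zero

-- In characteristic 2 the difference of `x` and `y` is `x ⊕ y`; if the two combinations agree, its
-- combination is zero, and independence makes it zero.
independent⇒injective : ∀ {W : 𝔽₂^ m → Set} {b : Fin d → 𝔽₂^ m} → IsBasis W b →
                        ∀ x y → combination b x ≗ combination b y → x ≗ y
independent⇒injective {b = b} B x y x≗y j =
  p+q≡0⇒p≡q (x j) (y j) (IsBasis.independent B (x ⊕ y) (λ i → begin
    combination b (x ⊕ y) i                ≡⟨ combination-⊕ b x y i ⟩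
    combination b x i + combination b y i  ≡⟨ cong (_+ combination b y i) (x≗y i) ⟩
    combination b y i + combination b y i  ≡⟨ p+p≡0ℙ (combination b y i) ⟩
    0ℙ                                     ∎) j)
  where open ≡-Reasoning

-- Scalars are recoded in `Fin 2` so that `funToFin` and `finToFun` can number the vectors of
-- `𝔽₂^ d` by `Fin (2 ^ d)`.
toBit : Parity → Fin 2
toBit 0ℙ = zero
toBit 1ℙ = suc zero

fromBit : Fin 2 → Parity
fromBit zero       = 0ℙ
fromBit (suc zero) = 1ℙ

toBit-fromBit : ∀ b → toBit (fromBit b) ≡ b
toBit-fromBit zero       = refl
toBit-fromBit (suc zero) = refl

fromBit-toBit : ∀ p → fromBit (toBit p) ≡ p
fromBit-toBit 0ℙ = refl
fromBit-toBit 1ℙ = refl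

funToFin-cong : ∀ {f g : Fin m → Fin n} → f ≗ g → funToFin f ≡ funToFin g
funToFin-cong {zero}  f≗g = refl
funToFin-cong {suc m} f≗g = cong₂ combine (f≗g zero) (funToFin-cong (f≗g ∘ suc))

^-cancelʳ-≤ : 2 ^ d ≤ 2 ^ e → d ≤ e
^-cancelʳ-≤ {d} {e} 2^d≤2^e = ℕ.≮⇒≥ λ e<d →
  ℕ.<⇒≱ (ℕ.^-monoʳ-< 2 (s≤s (s≤s z≤n)) e<d) 2^d≤2^e

-- By counting: 𝔽₂^ d has 2 ^ d elements.
injective⇒dim≤ : ∀ (f : 𝔽₂^ d → 𝔽₂^ e) → (∀ x y → f x ≗ f y → x ≗ y) → d ≤ e
injective⇒dim≤ {d} {e} f f-inj = ^-cancelʳ-≤ (injective⇒≤ {f = g} g-inj)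
  where
  open ≡-Reasoning
  decode : Fin (2 ^ d) → 𝔽₂^ d
  decode k = fromBit ∘ finToFun k
  g : Fin (2 ^ d) → Fin (2 ^ e)
  g k = funToFin (toBit ∘ f (decode k))
  encode-inj : ∀ (v w : 𝔽₂^ e) → funToFin (toBit ∘ v) ≡ funToFin (toBit ∘ w) → v ≗ w
  encode-inj v w eq i = begin
    v i                                             ≡⟨ fromBit-toBit (v i) ⟨
    fromBit (toBit (v i))                           ≡⟨ cong fromBit (finToFun-funToFin (toBit ∘ v) i) ⟨
    fromBit (finToFun (funToFin (toBit ∘ v)) i)     ≡⟨ cong (λ k → fromBit (finToFun k i)) eq ⟩
    fromBit (finToFun (funToFin (toBit ∘ w)) i)     ≡⟨ cong fromBit (finToFun-funToFin (toBit ∘ w) i) ⟩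
    fromBit (toBit (w i))                           ≡⟨ fromBit-toBit (w i) ⟩
    w i                                             ∎
  decode-inj : ∀ k l → decode k ≗ decode l → k ≡ l
  decode-inj k l eq = begin
    k                               ≡⟨ funToFin-finToFin {d} k ⟨
    funToFin (finToFun {2} {d} k)   ≡⟨ funToFin-cong (λ i → begin
      finToFun k i                    ≡⟨ toBit-fromBit _ ⟨
      toBit (decode k i)              ≡⟨ cong toBit (eq i) ⟩
      toBit (decode l i)              ≡⟨ toBit-fromBit _ ⟩
      finToFun l i                    ∎) ⟩
    funToFin (finToFun {2} {d} l)   ≡⟨ funToFin-finToFin {d} l ⟩
    l                               ∎
  g-inj : ∀ {k l} → g k ≡ g l → k ≡ l
  g-inj {k} {l} eq = decode-inj k l (f-inj _ _ (encode-inj _ _ eq))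

-- Sending `x` to the coordinates in `b′` of `f (combination b x)` is injective, since coordinates
-- determine the vector, `f` is injective on `W`, and `b` is independent. The bound then comes from
-- counting, so `f` can be an arbitrary map.
basis-size-≤ : ∀ {W : 𝔽₂^ m → Set} {W′ : 𝔽₂^ n → Set} {b : Fin d → 𝔽₂^ m} {b′ : Fin e → 𝔽₂^ n} →
               IsSubspace W → IsBasis W b → IsBasis W′ b′ → (f : 𝔽₂^ m → 𝔽₂^ n) →
               (∀ v → W v → W′ (f v)) → (∀ v w → W v → W w → f v ≗ f w → v ≗ w) → d ≤ e
basis-size-≤ {W = W} {b = b} {b′ = b′} S B B′ f f∈ f-inj =
  injective⇒dim≤ coordinates λ x y x≗y → independent⇒injective B x y
    (f-inj _ _ (b∈ x) (b∈ y) λ i → begin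
      f (combination b x) i              ≡⟨ proj₂ (image x) i ⟨
      combination b′ (coordinates x) i   ≡⟨ sum-cong-≗ (λ j → cong (_* b′ j i) (x≗y j)) ⟩
      combination b′ (coordinates y) i   ≡⟨ proj₂ (image y) i ⟩
      f (combination b y) i              ∎)
  where
  open ≡-Reasoning
  b∈ : ∀ x → W (combination b x)
  b∈ = combination-∈ S b (IsBasis.member B)
  image = λ x → IsBasis.spanning B′ (f (combination b x)) (f∈ _ (b∈ x))
  coordinates = λ x → proj₁ (image x)

nullity-≤ : ∀ {m n p q} (A : Matrix m n) (B : Matrix p q) (f : 𝔽₂^ n → 𝔽₂^ q) →
            (∀ v → Kernel A v → Kernel B (f v)) →
            (∀ v w → Kernel A v → Kernel A w → f v ≗ f w → v ≗ w) → nullity A ≤ nullity B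
nullity-≤ A B =
  basis-size-≤ (kernel-isSubspace A) (proj₂ (proj₂ (kernel-basis A))) (proj₂ (proj₂ (kernel-basis B)))

-- Complementary principal submatrices

∁-involutive : ∀ (ω : Subset n) → ∁ (∁ ω) ≡ ω
∁-involutive ω = begin
  ∁ (∁ ω)                  ≡⟨ Vec.map-∘ not not ω ⟨
  Vec.map (not ∘ not) ω    ≡⟨ Vec.map-cong not-involutive ω ⟩
  Vec.map id ω             ≡⟨ Vec.map-id ω ⟩
  ω                        ∎
  where open ≡-Reasoning

element-∈ : ∀ (ω : Subset n) i → element ω i ∈ ω
element-∈ (inside  ∷ ω) zero    = here
element-∈ (inside  ∷ ω) (suc i) = there (element-∈ ω i)
element-∈ (outside ∷ ω) i       = there (element-∈ ω i)

-- A case principle: an identity of vectors may be checked on `ω` and on `∁ ω` separately, in the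
-- enumerations by which principal submatrices are indexed.
element-cover : ∀ (ω : Subset n) {P : Fin n → Set} →
                (∀ i → P (element ω i)) → (∀ i → P (element (∁ ω) i)) → ∀ j → P j
element-cover (inside  ∷ ω) p q zero    = p zero
element-cover (inside  ∷ ω) p q (suc j) = element-cover ω (p ∘ suc) q j
element-cover (outside ∷ ω) p q zero    = q zero
element-cover (outside ∷ ω) p q (suc j) = element-cover ω p (q ∘ suc) j

extendByZero : ∀ (ω : Subset n) → 𝔽₂^ ∣ ω ∣ → 𝔽₂^ n
extendByZero (inside  ∷ ω) v zero    = head v
extendByZero (inside  ∷ ω) v (suc j) = extendByZero ω (tail v) j
extendByZero (outside ∷ ω) v zero    = 0ℙ
extendByZero (outside ∷ ω) v (suc j) = extendByZero ω v j

extendByZero-element : ∀ (ω : Subset n) v i → extendByZero ω v (element ω i) ≡ v i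
extendByZero-element (inside  ∷ ω) v zero    = refl
extendByZero-element (inside  ∷ ω) v (suc i) = extendByZero-element ω (tail v) i
extendByZero-element (outside ∷ ω) v i       = extendByZero-element ω v i

extendByZero-∉ : ∀ (ω : Subset n) v {j} → j ∉ ω → extendByZero ω v j ≡ 0ℙ
extendByZero-∉ (inside  ∷ ω) v {zero}  j∉ω = contradiction here j∉ω
extendByZero-∉ (inside  ∷ ω) v {suc j} j∉ω = extendByZero-∉ ω (tail v) (j∉ω ∘ there)
extendByZero-∉ (outside ∷ ω) v {zero}  j∉ω = refl
extendByZero-∉ (outside ∷ ω) v {suc j} j∉ω = extendByZero-∉ ω v (j∉ω ∘ there)

sum-extendByZero : ∀ (ω : Subset n) (r : 𝔽₂^ n) v →
                   sum (λ i → r (element ω i) * v i) ≡ sum (λ j → r j * extendByZero ω v j)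
sum-extendByZero []            r v = refl
sum-extendByZero (inside  ∷ ω) r v =
  cong (r zero * v zero +_) (sum-extendByZero ω (tail r) (tail v))
sum-extendByZero (outside ∷ ω) r v =
  ≡.trans (sum-extendByZero ω (tail r) v)
          (cong (_+ sum (λ j → tail r j * extendByZero ω v j)) (sym (*-zeroʳ (head r))))

-- The columns outside `ω` meet only zeros. Kernel conditions on a submatrix thus become conditions
-- on the full matrix, where `A²` applies.
⟦⟧-· : ∀ (A : Matrix n n) ω v i → (A ⟦ ω ⟧ · v) i ≡ (A · extendByZero ω v) (element ω i)
⟦⟧-· A ω v i = sum-extendByZero ω (A (element ω i)) v

module _ (A : Matrix n n) (A² : ∀ v → A · (A · v) ≗ v) where

  nullity-∁-≤ : ∀ ω → nullity (A ⟦ ω ⟧) ≤ nullity (A ⟦ ∁ ω ⟧)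
  nullity-∁-≤ ω = nullity-≤ (A ⟦ ω ⟧) (A ⟦ ∁ ω ⟧) f f∈ f-inj
    where
    open ≡-Reasoning
    image : 𝔽₂^ ∣ ω ∣ → 𝔽₂^ n
    image v = A · extendByZero ω v

    f : 𝔽₂^ ∣ ω ∣ → 𝔽₂^ ∣ ∁ ω ∣
    f v = image v ∘ element (∁ ω)

    image-ω : ∀ v → Kernel (A ⟦ ω ⟧) v → ∀ i → image v (element ω i) ≡ 0ℙ
    image-ω v Av i = ≡.trans (sym (⟦⟧-· A ω v i)) (Av i)

    -- Restricting `image v` to `∁ ω` loses nothing, as it already vanishes on `ω`.
    extend-f : ∀ v → Kernel (A ⟦ ω ⟧) v → extendByZero (∁ ω) (f v) ≗ image v
    extend-f v Av = element-cover ω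
      (λ i → ≡.trans (extendByZero-∉ (∁ ω) (f v) (x∈p⇒x∉∁p (element-∈ ω i))) (sym (image-ω v Av i)))
      (extendByZero-element (∁ ω) (f v))

    f∈ : ∀ v → Kernel (A ⟦ ω ⟧) v → Kernel (A ⟦ ∁ ω ⟧) (f v)
    f∈ v Av i = begin
      (A ⟦ ∁ ω ⟧ · f v) i                                ≡⟨ ⟦⟧-· A (∁ ω) (f v) i ⟩
      (A · extendByZero (∁ ω) (f v)) (element (∁ ω) i)   ≡⟨ ·-cong A (extend-f v Av) _ ⟩
      (A · image v) (element (∁ ω) i)                    ≡⟨ A² _ _ ⟩
      extendByZero ω v (element (∁ ω) i)                 ≡⟨ extendByZero-∉ ω v (x∈∁p⇒x∉p (element-∈ (∁ ω) i)) ⟩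
      0ℙ                                                 ∎

    -- `f v` fixes `image v` on `∁ ω`, and on `ω` it is zero; a second application of `A` returns
    -- the extension of `v`.
    f-inj : ∀ v w → Kernel (A ⟦ ω ⟧) v → Kernel (A ⟦ ω ⟧) w → f v ≗ f w → v ≗ w
    f-inj v w Av Aw fv≗fw i = begin
      v i                                  ≡⟨ extendByZero-element ω v i ⟨
      extendByZero ω v (element ω i)       ≡⟨ A² _ _ ⟨
      (A · image v) (element ω i)          ≡⟨ ·-cong A image≗ _ ⟩
      (A · image w) (element ω i)          ≡⟨ A² _ _ ⟩
      extendByZero ω w (element ω i)       ≡⟨ extendByZero-element ω w i ⟩
      w i                                  ∎
      where
      image≗ : image v ≗ image w
      image≗ = element-cover ω (λ j → ≡.trans (image-ω v Av j) (sym (image-ω w Aw j))) fv≗fw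

  nullity-∁ : ∀ ω → nullity (A ⟦ ω ⟧) ≡ nullity (A ⟦ ∁ ω ⟧)
  -- The reverse inequality is the same one for `∁ ω`, whose complement is `ω`.
  nullity-∁ ω = ℕ.≤-antisym (nullity-∁-≤ ω)
    (subst (λ ω′ → nullity (A ⟦ ∁ ω ⟧) ≤ nullity (A ⟦ ω′ ⟧)) (∁-involutive ω) (nullity-∁-≤ (∁ ω)))

-- The square of the adjacency matrix

indicator : Bool → 𝔽₂
indicator b = if b then 1ℙ else 0ℙ

indicator-∧ : ∀ b c → indicator (b ∧ c) ≡ indicator b * indicator c
indicator-∧ false _     = refl
indicator-∧ true  false = refl
indicator-∧ true  true  = refl

-- Reduction mod 2 is additive, so the cardinalities in strong regularity turn into 𝔽₂-sums of
-- matrix entries.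
parity-∣∣ : ∀ (ω : Subset n) → parity ∣ ω ∣ ≡ sum (indicator ∘ Vec.lookup ω)
parity-∣∣ []            = refl
parity-∣∣ (inside  ∷ ω) = ≡.trans (+-homo-+ 1 ∣ ω ∣) (cong (1ℙ +_) (parity-∣∣ ω))
parity-∣∣ (outside ∷ ω) = parity-∣∣ ω

parity-∣∩∣ : ∀ (χ ω : Subset n) →
             parity ∣ χ ∩ ω ∣ ≡ sum (λ j → indicator (Vec.lookup χ j) * indicator (Vec.lookup ω j))
parity-∣∩∣ χ ω = ≡.trans (parity-∣∣ (χ ∩ ω)) (sum-cong-≗ λ j →
  ≡.trans (cong indicator (Vec.lookup-zipWith _∧_ j χ ω)) (indicator-∧ (Vec.lookup χ j) _))

module _ (G : Graph n) where
  open Graph G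

  private
    Γ = adjacency G

  lookup-N : ∀ i j → indicator (Vec.lookup (N i) j) ≡ Γ i j
  lookup-N i j = cong indicator (Vec.lookup∘tabulate (λ j → does (i ~? j)) j)

  adjacency-sym : ∀ i j → Γ i j ≡ Γ j i
  adjacency-sym i j with i ~? j | j ~? i
  ... | yes _   | yes _   = refl
  ... | no  _   | no  _   = refl
  ... | yes i~j | no  j≁i = contradiction (~-sym i~j) j≁i
  ... | no  i≁j | yes j~i = contradiction (~-sym j~i) i≁j

  -- Entry (i, l) of the square is the number of common neighbors of i and l mod 2: `k`, hence 1, on
  -- the diagonal, and `a` or `c`, hence 0, off it.
  adjacency² : ∀ {k a c} → IsStronglyRegular G k a c → 2 ∤ k → 2 ∣ a → 2 ∣ c →
               ∀ v → Γ · (Γ · v) ≗ v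
  adjacency² {k} srg 2∤k 2∣a 2∣c v i = begin
    sum (λ j → Γ i j * sum (λ l → Γ j l * v l))
      ≡⟨ sum-cong-≗ (λ j → *-distribˡ-sum (Γ i j) (λ l → Γ j l * v l)) ⟩
    sum (λ j → sum (λ l → Γ i j * (Γ j l * v l)))
      ≡⟨ ∑-comm (λ j l → Γ i j * (Γ j l * v l)) ⟩
    sum (λ l → sum (λ j → Γ i j * (Γ j l * v l)))
      -- Symmetry makes both factors entries of rows, those of i and l, so that their product tests
      -- membership of j in `N i ∩ N l`.
      ≡⟨ sum-cong-≗ (λ l → sum-cong-≗ λ j → ≡.trans
           (cong (λ y → Γ i j * (y * v l)) (adjacency-sym j l)) (sym (*-assoc (Γ i j) _ _))) ⟩
    sum (λ l → sum (λ j → Γ i j * Γ l j * v l))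
      ≡⟨ sum-cong-≗ (λ l → *-distribʳ-sum (v l) (λ j → Γ i j * Γ l j)) ⟨
    sum (λ l → common i l * v l)
      ≡⟨ sum-select i _ (λ l i≢l → cong (_* v l) (common-distinct l i≢l)) ⟩
    common i i * v i
      ≡⟨ cong (_* v i) common-self ⟩
    v i ∎
    where
    open ≡-Reasoning
    open IsStronglyRegular srg

    common : Fin n → Fin n → 𝔽₂
    common i l = sum (λ j → Γ i j * Γ l j)

    common-self : common i i ≡ 1ℙ
    common-self = begin
      -- Squaring is the identity on 𝔽₂, so the diagonal entry is a plain row sum, the degree mod 2.
      common i i                           ≡⟨ sum-cong-≗ (λ j → *-idem (Γ i j)) ⟩
      sum (Γ i)                            ≡⟨ sum-cong-≗ (lookup-N i) ⟨
      sum (indicator ∘ Vec.lookup (N i))   ≡⟨ parity-∣∣ (N i) ⟨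
      parity ∣ N i ∣                       ≡⟨ cong parity (degree i) ⟩
      parity k                             ≡⟨ odd⇒parity≡1ℙ k 2∤k ⟩
      1ℙ                                   ∎

    ∣N∩N∣-even : ∀ l → i ≢ l → 2 ∣ ∣ N i ∩ N l ∣
    ∣N∩N∣-even l i≢l with i ~? l
    ... | yes i~l = subst (2 ∣_) (sym (adjacent i l i~l)) 2∣a
    ... | no  i≁l = subst (2 ∣_) (sym (nonadjacent i l i≢l i≁l)) 2∣c

    common-distinct : ∀ l → i ≢ l → common i l ≡ 0ℙ
    common-distinct l i≢l = begin
      common i l               ≡⟨ sum-cong-≗ (λ j → cong₂ _*_ (lookup-N i j) (lookup-N l j)) ⟨
      sum (λ j → indicator (Vec.lookup (N i) j) * indicator (Vec.lookup (N l) j))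
                               ≡⟨ parity-∣∩∣ (N i) (N l) ⟨
      parity ∣ N i ∩ N l ∣     ≡⟨ even⇒parity≡0ℙ (∣N∩N∣-even l i≢l) ⟩
      0ℙ                       ∎

-- Coefficients of sums of polynomials

-- In scope only from here on, because +_ makes sections such as (p +_) ambiguous.
open import Data.Integer.Base using (+_)

coeff-+ᴾ : ∀ p q i → coeff (p +ᴾ q) i ≡ coeff p i ℤ.+ coeff q i
coeff-+ᴾ []      q       i       = sym (ℤ.+-identityˡ _)
coeff-+ᴾ (a ∷ p) []      i       = sym (ℤ.+-identityʳ _)
coeff-+ᴾ (a ∷ p) (b ∷ q) zero    = refl
coeff-+ᴾ (a ∷ p) (b ∷ q) (suc i) = coeff-+ᴾ p q i

-- With the index `i` fixed, splitting and reordering the sum of polynomials becomes arithmetic in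
-- ℤ.
coeffSum : ℕ → List ℤ[x] → ℤ
coeffSum i = List.foldr (λ p s → coeff p i ℤ.+ s) 0ℤ

coeff-sumᴾ : ∀ ps i → coeff (sumᴾ ps) i ≡ coeffSum i ps
coeff-sumᴾ []       i = refl
coeff-sumᴾ (p ∷ ps) i = ≡.trans (coeff-+ᴾ p _ i) (cong (ℤ._+_ (coeff p i)) (coeff-sumᴾ ps i))

coeffSum-++ : ∀ i ps qs → coeffSum i (ps ++ qs) ≡ coeffSum i ps ℤ.+ coeffSum i qs
coeffSum-++ i []       qs = sym (ℤ.+-identityˡ _)
coeffSum-++ i (p ∷ ps) qs =
  ≡.trans (cong (ℤ._+_ (coeff p i)) (coeffSum-++ i ps qs)) (sym (ℤ.+-assoc (coeff p i) _ _))

coeffSum-↭ : ∀ i {ps qs} → ps ↭ qs → coeffSum i ps ≡ coeffSum i qs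
coeffSum-↭ i refl            = refl
coeffSum-↭ i (prep p ps↭qs)  = cong (ℤ._+_ (coeff p i)) (coeffSum-↭ i ps↭qs)
coeffSum-↭ i {qs = _ ∷ _ ∷ qs} (swap p q ps↭qs) = begin
  x ℤ.+ (y ℤ.+ _)      ≡⟨ cong (λ s → x ℤ.+ (y ℤ.+ s)) (coeffSum-↭ i ps↭qs) ⟩
  x ℤ.+ (y ℤ.+ s)      ≡⟨ ℤ.+-assoc x y s ⟨
  x ℤ.+ y ℤ.+ s        ≡⟨ cong (ℤ._+ s) (ℤ.+-comm x y) ⟩
  y ℤ.+ x ℤ.+ s        ≡⟨ ℤ.+-assoc y x s ⟩
  y ℤ.+ (x ℤ.+ s)      ∎
  where
  open ≡-Reasoning
  x = coeff p i
  y = coeff q i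
  s = coeffSum i qs
coeffSum-↭ i (trans ps↭qs qs↭rs) = ≡.trans (coeffSum-↭ i ps↭qs) (coeffSum-↭ i qs↭rs)

-- Pairing each subset with its complement

-- Complementation exchanges the subsets containing the first vertex with those avoiding it, and
-- acts on the remaining vertices by the induction hypothesis.
map-∁-subsets : ∀ n → List.map ∁ (subsets n) ↭ subsets n
map-∁-subsets zero    = refl
map-∁-subsets (suc n) = begin
  List.map ∁ (List.map (inside ∷_) S ++ List.map (outside ∷_) S)
    ≡⟨ map-++ ∁ (List.map (inside ∷_) S) _ ⟩
  List.map ∁ (List.map (inside ∷_) S) ++ List.map ∁ (List.map (outside ∷_) S)
    -- Fusing and splitting again suffices because `∁ (inside ∷ ω)` computes to `outside ∷ ∁ ω`, and
    -- likewise with the sides exchanged.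
    ≡⟨ cong₂ _++_ (≡.trans (sym (map-∘ S)) (map-∘ S)) (≡.trans (sym (map-∘ S)) (map-∘ S)) ⟩
  List.map (outside ∷_) (List.map ∁ S) ++ List.map (inside ∷_) (List.map ∁ S)
    ↭⟨ ++-comm (List.map (outside ∷_) (List.map ∁ S)) _ ⟩
  List.map (inside ∷_) (List.map ∁ S) ++ List.map (outside ∷_) (List.map ∁ S)
    ↭⟨ ++⁺ (map⁺ (inside ∷_) (map-∁-subsets n)) (map⁺ (outside ∷_) (map-∁-subsets n)) ⟩
  List.map (inside ∷_) S ++ List.map (outside ∷_) S ∎
  where
  open PermutationReasoning
  S = subsets n

2∣x+x : ∀ x → + 2 ℤ.∣ x ℤ.+ x
-- Integer divisibility is divisibility of absolute values in ℕ, hence the quotient `ℤ.∣ x ∣`.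
2∣x+x x = divides ℤ.∣ x ∣ (begin
  ℤ.∣ x ℤ.+ x ∣                   ≡⟨ cong ℤ.∣_∣ (cong₂ ℤ._+_ (ℤ.*-identityʳ x) (ℤ.*-identityʳ x)) ⟨
  ℤ.∣ x ℤ.* + 1 ℤ.+ x ℤ.* + 1 ∣   ≡⟨ cong ℤ.∣_∣ (ℤ.*-distribˡ-+ x (+ 1) (+ 1)) ⟨
  ℤ.∣ x ℤ.* + 2 ∣                 ≡⟨ ℤ.abs-* x (+ 2) ⟩
  ℤ.∣ x ∣ ℕ.* 2                   ∎)
  where open ≡-Reasoning

-- Exactly one of `ω` and `∁ ω` contains the first vertex, so the sum is twice its part over the
-- subsets containing that vertex. This is where a vertex must exist.
sum-over-subsets-even : ∀ n (F : Subset (suc n) → ℤ[x]) → (∀ ω → F ω ≡ F (∁ ω)) →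
                        ∀ i → + 2 ℤ.∣ coeff (sumᴾ (List.map F (subsets (suc n)))) i
sum-over-subsets-even n F F-∁ i = subst (+ 2 ℤ.∣_) (sym (begin
  coeff (sumᴾ (List.map F (List.map (inside ∷_) S ++ List.map (outside ∷_) S))) i
    ≡⟨ coeff-sumᴾ (List.map F (subsets (suc n))) i ⟩
  coeffSum i (List.map F (List.map (inside ∷_) S ++ List.map (outside ∷_) S))
    ≡⟨ cong (coeffSum i) (map-++ F (List.map (inside ∷_) S) _) ⟩
  coeffSum i (List.map F (List.map (inside ∷_) S) ++ List.map F (List.map (outside ∷_) S))
    ≡⟨ coeffSum-++ i (List.map F (List.map (inside ∷_) S)) _ ⟩
  coeffSum i (List.map F (List.map (inside ∷_) S)) ℤ.+ coeffSum i (List.map F (List.map (outside ∷_) S))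
    ≡⟨ cong₂ ℤ._+_ (cong (coeffSum i) (sym (map-∘ S))) outside≡inside ⟩
  half ℤ.+ half ∎)) (2∣x+x half)
  where
  open ≡-Reasoning
  S = subsets n
  half = coeffSum i (List.map (F ∘ (inside ∷_)) S)
  outside≡inside : coeffSum i (List.map F (List.map (outside ∷_) S)) ≡ half
  outside≡inside = begin
    coeffSum i (List.map F (List.map (outside ∷_) S))
      ≡⟨ cong (coeffSum i) (map-∘ S) ⟨
    coeffSum i (List.map (F ∘ (outside ∷_)) S)
      -- `F-∁` applies because the complement of `outside ∷ ω` computes to `inside ∷ ∁ ω`.
      ≡⟨ cong (coeffSum i) (map-cong (λ ω → F-∁ (outside ∷ ω)) S) ⟩
    coeffSum i (List.map (F ∘ (inside ∷_) ∘ ∁) S)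
      ≡⟨ cong (coeffSum i) (map-∘ S) ⟩
    coeffSum i (List.map (F ∘ (inside ∷_)) (List.map ∁ S))
      ≡⟨ coeffSum-↭ i (map⁺ (F ∘ (inside ∷_)) (map-∁-subsets n)) ⟩
    half ∎

corollary8 : ∀ {n k a c : ℕ} .{{_ : NonZero n}} (G : Graph n) →
    IsStronglyRegular G k a c →
    2 ∤ k → 2 ∣ a → 2 ∣ c →
    ∀ i → + 2 ℤ.∣ coeff (interlace G) i
-- For the graph without vertices the only term is that of the empty set, and the polynomial is the
-- constant 1; `NonZero n` rules this out.
corollary8 {n = suc n} G srg 2∤k 2∣a 2∣c = sum-over-subsets-even n _ λ ω →
  cong (x-1 ^ᴾ_) (nullity-∁ (adjacency G) (adjacency² G srg 2∤k 2∣a 2∣c) ω)
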